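{- Let $\frac{a}{b} < \frac{c}{d}$ be non-negative fractions in lowest terms (with $b,d>0$) whose cross-determinant is of the form $bc - ad = 2^m 3^n$ with integers $m,n \ge 0$. Then every rational number in the interval $\left[\frac{a}{b}, \frac{c}{d}\right]$ appears in some row $S_i\left(\frac{a}{b},\frac{c}{d}\right)$. Furthermore, after finitely many rows, each pair of consecutive elements in all subsequent rows has cross-determinant $1$; that is, there exists $L$ such that for all $i\ge L$ every two consecutive elements of $S_i\left(\frac{a}{b},\frac{c}{d}\right)$ have cross-determinant $1$.
   Context: All fractions are written in lowest terms with positive denominator. The cross-determinant of two consecutive reduced fractions $\frac{p}{q}, \frac{r}{s}$ (in this order) is $qr - ps$. The mediant of two reduced fractions $\frac{p}{q}$ and $\frac{r}{s}$ is the fraction $\frac{p+r}{q+s}$ put in lowest terms. Given two non-negative rational numbers $\frac{a}{b} < \frac{c}{d}$ in lowest terms, define finite sequences (rows) $S_i\left(\frac{a}{b},\frac{c}{d}\right)$, $i \ge 0$, of reduced fractions: $S_0 = \left(\frac{a}{b}, \frac{c}{d}\right)$, and $S_{i+1}$ is obtained from $S_i$ by copying all terms and inserting between every two consecutive terms their (reduced) mediant, where the mediant is computed from the reduced forms of the two terms. -}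

module Defs where

open import Data.Integer.Base as ℤ using (ℤ)
open import Data.List.Base using (List; []; _∷_)
open import Data.Nat.Base as ℕ using (ℕ; zero; suc)
open import Data.Rational.Base using (ℚ; ↥_; ↧_; ↧ₙ_; _/_)

-- A value of ℚ is by construction a fraction in lowest terms with positive
-- denominator, so ↥ and ↧ below are the reduced numerator and denominator.

crossDet : ℚ → ℚ → ℤ
crossDet x y = ↧ x ℤ.* ↥ y ℤ.- ↥ x ℤ.* ↧ y

-- _/_ puts the resulting fraction in lowest terms.
mediant : ℚ → ℚ → ℚ
mediant x y = (↥ x ℤ.+ ↥ y) / (↧ₙ x ℕ.+ ↧ₙ y)

insertMediants : List ℚ → List ℚ
insertMediants []           = []
insertMediants (x ∷ [])     = x ∷ []
insertMediants (x ∷ y ∷ zs) = x ∷ mediant x y ∷ insertMediants (y ∷ zs)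

row : ℚ → ℚ → ℕ → List ℚ
row x y zero    = x ∷ y ∷ []
row x y (suc i) = insertMediants (row x y i)

{-# OPTIONS --safe #-}
-- Let g be the factor cancelled in the mediant m of x and y. Both new
-- cross-determinants are (crossDet x y) / g.
--
-- Every rational is reached, whatever crossDet x y is: if x < q < m, then
-- g * crossDet q m = crossDet q y - crossDet x q, so the positive integer
-- crossDet x q + crossDet q y strictly decreases from (x , y) to (x , m), and
-- symmetrically from (x , y) to (m , y).
--
-- For the cross-determinants, view a reduced fraction as a primitive vector. If
-- d divides crossDet x y, then y ≡ k x mod d for some k, and k is not 0 mod d.
-- For d = 2 this forces x + y ≡ 0, so g > 1. For d = 3 either k ≡ -1 and again
-- g > 1, or k ≡ 1; in that case, if g = 1, then m = x + y ≡ -x ≡ -y mod 3 and a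
-- factor 3 cancels in the mediants of (x , m) and (m , y). So a cross-determinant
-- 2^m 3^n ≠ 1 is replaced by proper divisors within two rows.
module Submission where

open import Defs
open import Data.Integer.Base as ℤ using (ℤ; +_; -[1+_]; 0ℤ; 1ℤ)
open import Data.Integer.Divisibility.Signed as ℤ∣ using (divides; ∣ᵤ⇒∣; ∣⇒∣ᵤ)
open import Data.Integer.DivMod using (_/ℕ_; _%ℕ_; n%ℕd<d; a≡a%ℕn+[a/ℕn]*n)
import Data.Integer.Properties as ℤ
open import Data.Integer.Tactic.RingSolver using (solve-∀)
open import Data.List.Base using (List; []; _∷_)
open import Data.List.Membership.Propositional using (_∈_)
open import Data.List.Relation.Unary.Any using (here; there)
open import Data.List.Relation.Unary.Linked using (Linked; []; [-]; _∷_)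
open import Data.Nat.Base as ℕ using (ℕ; zero; suc; _^_; s≤s)
open import Data.Nat.Coprimality as Coprimality using (Coprime; coprime-Bézout)
import Data.Nat.Divisibility as ℕ
open import Data.Nat.GCD as ℕ using (module Bézout)
open import Data.Nat.Induction using (Acc; acc; <-wellFounded)
open import Data.Nat.Primality using (Prime; prime[2]; prime?; euclidsLemma; prime⇒nonZero)
import Data.Nat.Properties as ℕ
open import Data.Product.Base using (_×_; _,_; ∃-syntax; ∃₂)
open import Data.Rational.Base using (ℚ; mkℚ; 0ℚ; _≤_; _<_; ↥_; ↧_; ↧ₙ_)
import Data.Rational.Properties as ℚ
open import Data.Sum.Base using (_⊎_; inj₁; inj₂)
open import Relation.Binary.Definitions using (tri<; tri≈; tri>)
open import Relation.Binary.PropositionalEquality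
open import Relation.Nullary using (¬_; contradiction)
open import Relation.Nullary.Decidable using (from-yes)

-- Rows of adjacent intervals

-- as and bs overlap in the last entry of as, which is the first entry m of bs,
-- and cs is their union.
data Join (m : ℚ) : (as bs cs : List ℚ) → Set where
  meet : ∀ {ys} → Join m (m ∷ []) (m ∷ ys) (m ∷ ys)
  step : ∀ {x as bs cs} → Join m as bs cs → Join m (x ∷ as) bs (x ∷ cs)

module _ {m : ℚ} where

  Join-insertMediants : ∀ {as bs cs} → Join m as bs cs →
    Join m (insertMediants as) (insertMediants bs) (insertMediants cs)
  Join-insertMediants (meet {[]})       = meet
  Join-insertMediants (meet {_ ∷ _})    = meet
  -- Splitting on `j` exposes the second entries, without which `insertMediants` does not compute.
  Join-insertMediants (step j@meet)     = step (step (Join-insertMediants j))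
  Join-insertMediants (step j@(step _)) = step (step (Join-insertMediants j))

  Join-∈ˡ : ∀ {as bs cs q} → Join m as bs cs → q ∈ as → q ∈ cs
  Join-∈ˡ meet     (here refl)  = here refl
  Join-∈ˡ (step j) (here refl)  = here refl
  Join-∈ˡ (step j) (there q∈as) = there (Join-∈ˡ j q∈as)

  Join-∈ʳ : ∀ {as bs cs q} → Join m as bs cs → q ∈ bs → q ∈ cs
  Join-∈ʳ meet     q∈bs = q∈bs
  Join-∈ʳ (step j) q∈bs = there (Join-∈ʳ j q∈bs)

  Join-Linked : ∀ {R : ℚ → ℚ → Set} {as bs cs} → Join m as bs cs →
    Linked R as → Linked R bs → Linked R cs
  Join-Linked meet              _        ls = ls
  Join-Linked (step j@meet)     (r ∷ ks) ls = r ∷ Join-Linked j ks ls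
  Join-Linked (step j@(step _)) (r ∷ ks) ls = r ∷ Join-Linked j ks ls

-- `row` puts the newest insertion outermost. This exchanges it for a recursion on the first
-- insertion, so that both claims about rows reduce to the intervals on either side of `m`.
row-Join : ∀ x y i → let m = mediant x y in
  Join m (row x m i) (row m y i) (row x y (suc i))
row-Join x y zero    = step meet
row-Join x y (suc i) = Join-insertMediants (row-Join x y i)

-- Mediants and cross-determinants

-- The factor g of the opening comment: `_/_` divides both coordinates by exactly this gcd.
scale : ℚ → ℚ → ℕ
scale x y = ℕ.gcd ℤ.∣ ↥ x ℤ.+ ↥ y ∣ (↧ₙ x ℕ.+ ↧ₙ y)

module _ (x y : ℚ) where

  private m = mediant x y

  scale>0 : 0 ℕ.< scale x y
  scale>0 = ℕ.n≢0⇒n>0 (ℕ.gcd[m,n]≢0 ℤ.∣ ↥ x ℤ.+ ↥ y ∣ (↧ₙ x ℕ.+ ↧ₙ y) (inj₂ λ ()))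

  ↥-mediant : ↥ m ℤ.* + scale x y ≡ ↥ x ℤ.+ ↥ y
  ↥-mediant = ℚ.↥-/ (↥ x ℤ.+ ↥ y) (↧ₙ x ℕ.+ ↧ₙ y)

  ↧-mediant : ↧ m ℤ.* + scale x y ≡ ↧ x ℤ.+ ↧ y
  ↧-mediant = ℚ.↧-/ (↥ x ℤ.+ ↥ y) (↧ₙ x ℕ.+ ↧ₙ y)

  -- `crossDet q` is linear in the numerator-denominator vector of its second argument, and g times
  -- the vector of `m` is the sum of those of `x` and `y`.
  crossDet-mediantʳ : ∀ q → crossDet q m ℤ.* + scale x y ≡ crossDet q x ℤ.+ crossDet q y
  crossDet-mediantʳ q = begin
    crossDet q m ℤ.* + scale x y
      ≡⟨ distrib (↧ q) (↥ m) (↥ q) (↧ m) (+ scale x y) ⟩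
    ↧ q ℤ.* (↥ m ℤ.* + scale x y) ℤ.- ↥ q ℤ.* (↧ m ℤ.* + scale x y)
      ≡⟨ cong₂ (λ a b → ↧ q ℤ.* a ℤ.- ↥ q ℤ.* b) ↥-mediant ↧-mediant ⟩
    ↧ q ℤ.* (↥ x ℤ.+ ↥ y) ℤ.- ↥ q ℤ.* (↧ x ℤ.+ ↧ y)
      ≡⟨ regroup (↧ q) (↥ q) (↥ x) (↥ y) (↧ x) (↧ y) ⟩
    crossDet q x ℤ.+ crossDet q y ∎
    where
    open ≡-Reasoning
    distrib : ∀ a b c d g →
      (a ℤ.* b ℤ.- c ℤ.* d) ℤ.* g ≡ a ℤ.* (b ℤ.* g) ℤ.- c ℤ.* (d ℤ.* g)
    distrib = solve-∀
    regroup : ∀ a c x y x′ y′ → a ℤ.* (x ℤ.+ y) ℤ.- c ℤ.* (x′ ℤ.+ y′) ≡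
      (a ℤ.* x ℤ.- c ℤ.* x′) ℤ.+ (a ℤ.* y ℤ.- c ℤ.* y′)
    regroup = solve-∀

crossDet-antisym : ∀ x y → crossDet x y ≡ ℤ.- crossDet y x
crossDet-antisym x y = swap (↧ x) (↥ y) (↥ x) (↧ y)
  where
  swap : ∀ a b c d → a ℤ.* b ℤ.- c ℤ.* d ≡ ℤ.- (d ℤ.* c ℤ.- b ℤ.* a)
  swap = solve-∀

crossDet-refl : ∀ x → crossDet x x ≡ 0ℤ
crossDet-refl x = cancel (↧ x) (↥ x)
  where
  cancel : ∀ a b → a ℤ.* b ℤ.- b ℤ.* a ≡ 0ℤ
  cancel = solve-∀

crossDet-mediantˡ : ∀ x y q →
  crossDet (mediant x y) q ℤ.* + scale x y ≡ crossDet x q ℤ.+ crossDet y q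
crossDet-mediantˡ x y q = begin
  crossDet m q ℤ.* g                    ≡⟨ cong (ℤ._* g) (crossDet-antisym m q) ⟩
  ℤ.- crossDet q m ℤ.* g                ≡⟨ ℤ.neg-distribˡ-* (crossDet q m) g ⟨
  ℤ.- (crossDet q m ℤ.* g)              ≡⟨ cong ℤ.-_ (crossDet-mediantʳ x y q) ⟩
  ℤ.- (crossDet q x ℤ.+ crossDet q y)   ≡⟨ ℤ.neg-distrib-+ (crossDet q x) (crossDet q y) ⟩
  ℤ.- crossDet q x ℤ.+ ℤ.- crossDet q y ≡⟨ cong₂ ℤ._+_ (crossDet-antisym x q) (crossDet-antisym y q) ⟨
  crossDet x q ℤ.+ crossDet y q         ∎
  where
  open ≡-Reasoning
  m = mediant x y
  g = + scale x y

crossDet-lower : ∀ x y → crossDet x (mediant x y) ℤ.* + scale x y ≡ crossDet x y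
crossDet-lower x y = trans (crossDet-mediantʳ x y x)
  (trans (cong (ℤ._+ crossDet x y) (crossDet-refl x)) (ℤ.+-identityˡ _))

crossDet-upper : ∀ x y → crossDet (mediant x y) y ℤ.* + scale x y ≡ crossDet x y
crossDet-upper x y = trans (crossDet-mediantˡ x y y)
  (trans (cong (λ i → crossDet x y ℤ.+ i) (crossDet-refl y)) (ℤ.+-identityʳ _))

-- Every rational of the interval appears

<⇒crossDet>0 : ∀ {x y} → x < y → 0ℤ ℤ.< crossDet x y
<⇒crossDet>0 {x} {y} x<y = subst₂ ℤ._<_ (ℤ.+-inverseʳ (↥ x ℤ.* ↧ y))
  (cong (ℤ._- ↥ x ℤ.* ↧ y) (ℤ.*-comm (↥ y) (↧ x)))
  (ℤ.+-monoˡ-< (ℤ.- (↥ x ℤ.* ↧ y)) (ℚ.drop-*<* x<y))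

i≤i*n : ∀ {i n} → 0ℤ ℤ.< i → 0 ℕ.< n → i ℤ.≤ i ℤ.* + n
i≤i*n {+ i} {n} _ 0<n = subst (+ i ℤ.≤_) (ℤ.pos-* i n)
  (ℤ.+≤+ (ℕ.m≤m*n i n {{ℕ.>-nonZero 0<n}}))

potential : ℚ → ℚ → ℚ → ℤ
potential x q y = crossDet x q ℤ.+ crossDet q y

-- As `qm` is positive, multiplying it by g does not decrease it, and the product is `qy - xq`. What
-- remains is `qy`, smaller than `xq + qy` because `x < q`.
potential-lower : ∀ {x q y} → x < q → q < mediant x y →
  potential x q (mediant x y) ℤ.< potential x q y
potential-lower {x} {q} {y} x<q q<m = begin-strict
  xq ℤ.+ qm                ≤⟨ ℤ.+-monoʳ-≤ xq (i≤i*n (<⇒crossDet>0 q<m) (scale>0 x y)) ⟩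
  xq ℤ.+ qm ℤ.* + g        ≡⟨ cong (λ i → xq ℤ.+ i) (crossDet-mediantʳ x y q) ⟩
  xq ℤ.+ (crossDet q x ℤ.+ qy)
                           ≡⟨ cong (λ i → xq ℤ.+ (i ℤ.+ qy)) (crossDet-antisym q x) ⟩
  xq ℤ.+ (ℤ.- xq ℤ.+ qy)   ≡⟨ cancel xq qy ⟩
  0ℤ ℤ.+ qy                <⟨ ℤ.+-monoˡ-< qy (<⇒crossDet>0 x<q) ⟩
  xq ℤ.+ qy                ∎
  where
  open ℤ.≤-Reasoning
  xq = crossDet x q
  qy = crossDet q y
  qm = crossDet q (mediant x y)
  g  = scale x y
  cancel : ∀ a b → a ℤ.+ (ℤ.- a ℤ.+ b) ≡ 0ℤ ℤ.+ b
  cancel = solve-∀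

potential-upper : ∀ {x q y} → mediant x y < q → q < y →
  potential (mediant x y) q y ℤ.< potential x q y
potential-upper {x} {q} {y} m<q q<y = begin-strict
  mq ℤ.+ qy                ≤⟨ ℤ.+-monoˡ-≤ qy (i≤i*n (<⇒crossDet>0 m<q) (scale>0 x y)) ⟩
  mq ℤ.* + g ℤ.+ qy        ≡⟨ cong (ℤ._+ qy) (crossDet-mediantˡ x y q) ⟩
  xq ℤ.+ crossDet y q ℤ.+ qy
                           ≡⟨ cong (λ i → xq ℤ.+ i ℤ.+ qy) (crossDet-antisym y q) ⟩
  xq ℤ.+ ℤ.- qy ℤ.+ qy     ≡⟨ cancel xq qy ⟩
  xq ℤ.+ 0ℤ                <⟨ ℤ.+-monoʳ-< xq (<⇒crossDet>0 q<y) ⟩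
  xq ℤ.+ qy                ∎
  where
  open ℤ.≤-Reasoning
  xq = crossDet x q
  qy = crossDet q y
  mq = crossDet (mediant x y) q
  g  = scale x y
  cancel : ∀ a b → a ℤ.+ ℤ.- b ℤ.+ b ≡ a ℤ.+ 0ℤ
  cancel = solve-∀

-- The bound `n` makes the recursion structural: a strict decrease of the potential lowers the bound
-- by one, and bound 0 contradicts the positivity of both summands.
appears : ∀ n {x q y} → potential x q y ℤ.≤ + n → x < q → q < y → ∃[ i ] q ∈ row x y i
appears zero P≤0 x<q q<y =
  contradiction (ℤ.+-mono-< (<⇒crossDet>0 x<q) (<⇒crossDet>0 q<y)) (ℤ.≤⇒≯ P≤0)
appears (suc n) {x} {q} {y} P≤1+n x<q q<y with ℚ.<-cmp q (mediant x y)
... | tri≈ _ refl _ = 1 , there (here refl)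
... | tri< q<m _ _ =
  let i , q∈ = appears n (ℤ.i<j⇒i≤pred[j] {j = + suc n} (ℤ.<-≤-trans (potential-lower {x} {q} {y} x<q q<m) P≤1+n)) x<q q<m
  in suc i , Join-∈ˡ (row-Join x y i) q∈
... | tri> _ _ m<q =
  let i , q∈ = appears n (ℤ.i<j⇒i≤pred[j] {j = + suc n} (ℤ.<-≤-trans (potential-upper {x} {q} {y} m<q q<y) P≤1+n)) m<q q<y
  in suc i , Join-∈ʳ (row-Join x y i) q∈

i≤∣i∣ : ∀ i → i ℤ.≤ + ℤ.∣ i ∣
i≤∣i∣ (+ _)    = ℤ.≤-refl
i≤∣i∣ -[1+ _ ] = ℤ.-≤+

appears-closed : ∀ {x q y} → x ≤ q → q ≤ y → ∃[ i ] q ∈ row x y i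
appears-closed {x} {q} {y} x≤q q≤y with ℚ.<-cmp x q | ℚ.<-cmp q y
... | tri> _ _ q<x  | _             = contradiction (ℚ.<-≤-trans q<x x≤q) (ℚ.<-irrefl refl)
... | tri≈ _ refl _ | _             = 0 , here refl
... | tri< _ _ _    | tri> _ _ y<q  = contradiction (ℚ.<-≤-trans y<q q≤y) (ℚ.<-irrefl refl)
... | tri< _ _ _    | tri≈ _ refl _ = 0 , there (here refl)
... | tri< x<q _ _  | tri< q<y _ _  = appears ℤ.∣ potential x q y ∣ (i≤∣i∣ _) x<q q<y

-- Reduced fractions as primitive vectors

Bézout-ℤ : ∀ i n → Coprime ℤ.∣ i ∣ n → ∃₂ λ a b → a ℤ.* i ℤ.+ b ℤ.* + n ≡ 1ℤ
Bézout-ℤ (+ m) n c with coprime-Bézout c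
... | Bézout.+- a b eq = + a , ℤ.- + b , (begin
  + a ℤ.* + m ℤ.+ ℤ.- + b ℤ.* + n         ≡⟨ cong (ℤ._+ ℤ.- + b ℤ.* + n) (ℤ.pos-* a m) ⟨
  + (a ℕ.* m) ℤ.+ ℤ.- + b ℤ.* + n         ≡⟨ cong (λ k → + k ℤ.+ ℤ.- + b ℤ.* + n) eq ⟨
  1ℤ ℤ.+ + (b ℕ.* n) ℤ.+ ℤ.- + b ℤ.* + n  ≡⟨ cong (λ k → 1ℤ ℤ.+ k ℤ.+ ℤ.- + b ℤ.* + n) (ℤ.pos-* b n) ⟩
  1ℤ ℤ.+ + b ℤ.* + n ℤ.+ ℤ.- + b ℤ.* + n  ≡⟨ cancel (+ b) (+ n) ⟩
  1ℤ                                      ∎)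
  where
  open ≡-Reasoning
  cancel : ∀ b n → 1ℤ ℤ.+ b ℤ.* n ℤ.+ ℤ.- b ℤ.* n ≡ 1ℤ
  cancel = solve-∀
... | Bézout.-+ a b eq = ℤ.- + a , + b , (begin
  ℤ.- + a ℤ.* + m ℤ.+ + b ℤ.* + n           ≡⟨ cong (λ k → ℤ.- + a ℤ.* + m ℤ.+ k) (ℤ.pos-* b n) ⟨
  ℤ.- + a ℤ.* + m ℤ.+ + (b ℕ.* n)           ≡⟨ cong (λ k → ℤ.- + a ℤ.* + m ℤ.+ + k) eq ⟨
  ℤ.- + a ℤ.* + m ℤ.+ (1ℤ ℤ.+ + (a ℕ.* m))  ≡⟨ cong (λ k → ℤ.- + a ℤ.* + m ℤ.+ (1ℤ ℤ.+ k)) (ℤ.pos-* a m) ⟩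
  ℤ.- + a ℤ.* + m ℤ.+ (1ℤ ℤ.+ + a ℤ.* + m)  ≡⟨ cancel (+ a) (+ m) ⟩
  1ℤ                                        ∎)
  where
  open ≡-Reasoning
  cancel : ∀ a m → ℤ.- a ℤ.* m ℤ.+ (1ℤ ℤ.+ a ℤ.* m) ≡ 1ℤ
  cancel = solve-∀
Bézout-ℤ -[1+ m ] n c =
  let a , b , eq = Bézout-ℤ (+ suc m) n c
  in ℤ.- a , b , trans (cong (ℤ._+ b ℤ.* + n) (neg*neg a (+ suc m))) eq
  where
  neg*neg : ∀ a m → ℤ.- a ℤ.* ℤ.- m ≡ a ℤ.* m
  neg*neg = solve-∀

Bézout-ℚ : ∀ x → ∃₂ λ a b → a ℤ.* ↥ x ℤ.+ b ℤ.* ↧ x ≡ 1ℤ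
-- The coprimality proof stored in a rational is irrelevant, so a usable one is recomputed.
Bézout-ℚ (mkℚ n d-1 c) = Bézout-ℤ n (suc d-1) (Coprimality.recompute c)

∣↥∧∣↧⇒∣1 : ∀ {d} x → d ℤ∣.∣ ↥ x → d ℤ∣.∣ ↧ x → d ℤ∣.∣ 1ℤ
∣↥∧∣↧⇒∣1 {d} x d∣↥ d∣↧ =
  let a , b , eq = Bézout-ℚ x
  in subst (d ℤ∣.∣_) eq (ℤ∣.∣m∣n⇒∣m+n (ℤ∣.∣n⇒∣m*n a d∣↥) (ℤ∣.∣n⇒∣m*n b d∣↧))

-- The congruence y ≡ k x mod d of primitive vectors, coordinate by coordinate.
record Multiple (d k : ℤ) (x y : ℚ) : Set where
  constructor multiple
  field
    ∣↥ : d ℤ∣.∣ ↥ y ℤ.- k ℤ.* ↥ x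
    ∣↧ : d ℤ∣.∣ ↧ y ℤ.- k ℤ.* ↧ x

-- Bézout gives a linear form with value 1 at `x`; its value at `y` is the multiplier `k`. The
-- coordinates of y - k x are then `b` and `- a` times the cross-determinant.
∣crossDet⇒Multiple : ∀ {d} x y → d ℤ∣.∣ crossDet x y → ∃[ k ] Multiple d k x y
∣crossDet⇒Multiple {d} x y d∣D = k , multiple
  (subst (d ℤ∣.∣_) (sym ↥-eq) (ℤ∣.∣n⇒∣m*n b d∣D))
  (subst (d ℤ∣.∣_) (sym ↧-eq) (ℤ∣.∣n⇒∣m*n (ℤ.- a) d∣D))
  where
  bez = Bézout-ℚ x
  a = let a , _ = bez in a
  b = let _ , b , _ = bez in b
  eq : a ℤ.* ↥ x ℤ.+ b ℤ.* ↧ x ≡ 1ℤ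
  eq = let _ , _ , eq = bez in eq
  k = a ℤ.* ↥ y ℤ.+ b ℤ.* ↧ y
  expand : ∀ c → c ≡ c ℤ.* (a ℤ.* ↥ x ℤ.+ b ℤ.* ↧ x)
  expand c = trans (sym (ℤ.*-identityʳ c)) (cong (c ℤ.*_) (sym eq))
  ↥-poly : ∀ a b p q r s → r ℤ.* (a ℤ.* p ℤ.+ b ℤ.* q) ℤ.- (a ℤ.* r ℤ.+ b ℤ.* s) ℤ.* p ≡
    b ℤ.* (q ℤ.* r ℤ.- p ℤ.* s)
  ↥-poly = solve-∀
  ↧-poly : ∀ a b p q r s → s ℤ.* (a ℤ.* p ℤ.+ b ℤ.* q) ℤ.- (a ℤ.* r ℤ.+ b ℤ.* s) ℤ.* q ≡
    ℤ.- a ℤ.* (q ℤ.* r ℤ.- p ℤ.* s)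
  ↧-poly = solve-∀
  ↥-eq : ↥ y ℤ.- k ℤ.* ↥ x ≡ b ℤ.* crossDet x y
  ↥-eq = trans (cong (ℤ._- k ℤ.* ↥ x) (expand (↥ y))) (↥-poly a b (↥ x) (↧ x) (↥ y) (↧ y))
  ↧-eq : ↧ y ℤ.- k ℤ.* ↧ x ≡ ℤ.- a ℤ.* crossDet x y
  ↧-eq = trans (cong (ℤ._- k ℤ.* ↧ x) (expand (↧ y))) (↧-poly a b (↥ x) (↧ x) (↥ y) (↧ y))

∣-shift : ∀ {d i k} j → d ℤ∣.∣ i → d ℤ∣.∣ k → d ℤ∣.∣ i ℤ.+ k ℤ.* j
∣-shift j d∣i d∣k = ℤ∣.∣m∣n⇒∣m+n d∣i (ℤ∣.∣m⇒∣m*n j d∣k)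

Multiple-cong : ∀ {d k} l {x y} → d ℤ∣.∣ k ℤ.- l → Multiple d k x y → Multiple d l x y
Multiple-cong {d} {k} l {x} {y} d∣k-l (multiple d∣↥ d∣↧) = multiple
  (subst (d ℤ∣.∣_) (collect (↥ y) (↥ x) k l) (∣-shift (↥ x) d∣↥ d∣k-l))
  (subst (d ℤ∣.∣_) (collect (↧ y) (↧ x) k l) (∣-shift (↧ x) d∣↧ d∣k-l))
  where
  collect : ∀ c e k l → c ℤ.- k ℤ.* e ℤ.+ (k ℤ.- l) ℤ.* e ≡ c ℤ.- l ℤ.* e
  collect = solve-∀

-- Otherwise `d` would divide both numerator and denominator of the reduced fraction `y`.
¬Multiple-0 : ∀ {d x y} → 1 ℕ.< d → ¬ Multiple (+ d) 0ℤ x y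
¬Multiple-0 {d} {x} {y} 1<d (multiple d∣↥ d∣↧) = ℕ.>⇒∤ 1<d (∣⇒∣ᵤ (∣↥∧∣↧⇒∣1 y
  (subst (+ d ℤ∣.∣_) (drop (↥ y) (↥ x)) d∣↥) (subst (+ d ℤ∣.∣_) (drop (↧ y) (↧ x)) d∣↧)))
  where
  drop : ∀ c e → c ℤ.- 0ℤ ℤ.* e ≡ c
  drop = solve-∀

Multiple-neg⇒∣scale : ∀ {d} x y → Multiple (+ d) ℤ.-1ℤ x y → d ℕ.∣ scale x y
Multiple-neg⇒∣scale {d} x y (multiple d∣↥ d∣↧) = ℕ.gcd-greatest
  (∣⇒∣ᵤ (subst (+ d ℤ∣.∣_) (add (↥ y) (↥ x)) d∣↥))
  (∣⇒∣ᵤ (subst (+ d ℤ∣.∣_) (add (↧ y) (↧ x)) d∣↧))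
  where
  add : ∀ c e → c ℤ.- ℤ.-1ℤ ℤ.* e ≡ e ℤ.+ c
  add = solve-∀

-- Forced cancellation modulo 2 and 3

residue₂ : ∀ k → + 2 ℤ∣.∣ k ℤ.- 0ℤ ⊎ + 2 ℤ∣.∣ k ℤ.- ℤ.-1ℤ
residue₂ k with k %ℕ 2 | n%ℕd<d k 2 | a≡a%ℕn+[a/ℕn]*n k 2
... | 0           | _                 | eq =
  inj₁ (divides (k /ℕ 2) (trans (cong (ℤ._- 0ℤ) eq) (p (k /ℕ 2))))
  where
  p : ∀ q → + 0 ℤ.+ q ℤ.* + 2 ℤ.- 0ℤ ≡ q ℤ.* + 2
  p = solve-∀
... | 1           | _                 | eq =
  -- Remainder 1 is read as -1, the class in which x + y vanishes: k + 1 = 2 (q + 1).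
  inj₂ (divides (k /ℕ 2 ℤ.+ 1ℤ) (trans (cong (ℤ._- ℤ.-1ℤ) eq) (p (k /ℕ 2))))
  where
  p : ∀ q → + 1 ℤ.+ q ℤ.* + 2 ℤ.- ℤ.-1ℤ ≡ (q ℤ.+ 1ℤ) ℤ.* + 2
  p = solve-∀
... | suc (suc _) | s≤s (s≤s ())      | _

residue₃ : ∀ k → + 3 ℤ∣.∣ k ℤ.- 0ℤ ⊎ + 3 ℤ∣.∣ k ℤ.- 1ℤ ⊎ + 3 ℤ∣.∣ k ℤ.- ℤ.-1ℤ
residue₃ k with k %ℕ 3 | n%ℕd<d k 3 | a≡a%ℕn+[a/ℕn]*n k 3
... | 0           | _ | eq =
  inj₁ (divides (k /ℕ 3) (trans (cong (ℤ._- 0ℤ) eq) (p (k /ℕ 3))))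
  where
  p : ∀ q → + 0 ℤ.+ q ℤ.* + 3 ℤ.- 0ℤ ≡ q ℤ.* + 3
  p = solve-∀
... | 1           | _ | eq =
  inj₂ (inj₁ (divides (k /ℕ 3) (trans (cong (ℤ._- 1ℤ) eq) (p (k /ℕ 3)))))
  where
  p : ∀ q → + 1 ℤ.+ q ℤ.* + 3 ℤ.- 1ℤ ≡ q ℤ.* + 3
  p = solve-∀
... | 2           | _ | eq =
  inj₂ (inj₂ (divides (k /ℕ 3 ℤ.+ 1ℤ) (trans (cong (ℤ._- ℤ.-1ℤ) eq) (p (k /ℕ 3)))))
  where
  p : ∀ q → + 2 ℤ.+ q ℤ.* + 3 ℤ.- ℤ.-1ℤ ≡ (q ℤ.+ 1ℤ) ℤ.* + 3
  p = solve-∀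
... | suc (suc (suc _)) | s≤s (s≤s (s≤s ())) | _

2∣crossDet⇒2∣scale : ∀ x y → + 2 ℤ∣.∣ crossDet x y → 2 ℕ.∣ scale x y
2∣crossDet⇒2∣scale x y 2∣D with k , y≡kx ← ∣crossDet⇒Multiple x y 2∣D | residue₂ k
... | inj₁ k≡0  = contradiction (Multiple-cong 0ℤ k≡0 y≡kx) (¬Multiple-0 ℕ.sz<ss)
... | inj₂ k≡-1 = Multiple-neg⇒∣scale x y (Multiple-cong ℤ.-1ℤ k≡-1 y≡kx)

module _ {x y : ℚ} (g≡1 : scale x y ≡ 1) where

  private
    m = mediant x y

    unscale : ∀ {i j} → i ℤ.* + scale x y ≡ j → i ≡ j
    unscale {i} eq = trans (sym (ℤ.*-identityʳ i)) (trans (cong (λ g → i ℤ.* + g) (sym g≡1)) eq)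

    ↥m : ↥ m ≡ ↥ x ℤ.+ ↥ y
    ↥m = unscale (↥-mediant x y)

    ↧m : ↧ m ≡ ↧ x ℤ.+ ↧ y
    ↧m = unscale (↧-mediant x y)

  -- With nothing cancelled, m + x = (y - x) + 3 x.
  Multiple₃-lower : Multiple (+ 3) 1ℤ x y → Multiple (+ 3) ℤ.-1ℤ x m
  Multiple₃-lower (multiple 3∣↥ 3∣↧) = multiple (component (↥ x) (↥ y) ↥m 3∣↥) (component (↧ x) (↧ y) ↧m 3∣↧)
    where
    collect : ∀ e c → c ℤ.- 1ℤ ℤ.* e ℤ.+ + 3 ℤ.* e ≡ e ℤ.+ c ℤ.- ℤ.-1ℤ ℤ.* e
    collect = solve-∀
    component : ∀ e c {f} → f ≡ e ℤ.+ c → + 3 ℤ∣.∣ c ℤ.- 1ℤ ℤ.* e → + 3 ℤ∣.∣ f ℤ.- ℤ.-1ℤ ℤ.* e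
    component e c refl 3∣ = subst (+ 3 ℤ∣.∣_) (collect e c) (∣-shift e 3∣ ℤ∣.∣-refl)

  -- With nothing cancelled, y + m = 3 y - (y - x).
  Multiple₃-upper : Multiple (+ 3) 1ℤ x y → Multiple (+ 3) ℤ.-1ℤ m y
  Multiple₃-upper (multiple 3∣↥ 3∣↧) = multiple (component (↥ x) (↥ y) ↥m 3∣↥) (component (↧ x) (↧ y) ↧m 3∣↧)
    where
    collect : ∀ e c → ℤ.- (c ℤ.- 1ℤ ℤ.* e) ℤ.+ + 3 ℤ.* c ≡ c ℤ.- ℤ.-1ℤ ℤ.* (e ℤ.+ c)
    collect = solve-∀
    component : ∀ e c {f} → f ≡ e ℤ.+ c → + 3 ℤ∣.∣ c ℤ.- 1ℤ ℤ.* e → + 3 ℤ∣.∣ c ℤ.- ℤ.-1ℤ ℤ.* f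
    component e c refl 3∣ =
      subst (+ 3 ℤ∣.∣_) (collect e c) (∣-shift c (ℤ∣.∣m⇒∣-m 3∣) ℤ∣.∣-refl)

-- The second alternative assumes g = 1, which makes `m` the exact vector sum; if g > 1, the
-- cross-determinants drop at once anyway.
3∣crossDet⇒3∣scale : ∀ x y → + 3 ℤ∣.∣ crossDet x y →
  3 ℕ.∣ scale x y ⊎
  (scale x y ≡ 1 → 3 ℕ.∣ scale x (mediant x y) × 3 ℕ.∣ scale (mediant x y) y)
3∣crossDet⇒3∣scale x y 3∣D with k , y≡kx ← ∣crossDet⇒Multiple x y 3∣D | residue₃ k
... | inj₁ k≡0         = contradiction (Multiple-cong 0ℤ k≡0 y≡kx) (¬Multiple-0 ℕ.sz<ss)
... | inj₂ (inj₂ k≡-1) = inj₁ (Multiple-neg⇒∣scale x y (Multiple-cong ℤ.-1ℤ k≡-1 y≡kx))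
... | inj₂ (inj₁ k≡1)  = inj₂ λ g≡1 →
  Multiple-neg⇒∣scale x m (Multiple₃-lower g≡1 y≡x) ,
  Multiple-neg⇒∣scale m y (Multiple₃-upper g≡1 y≡x)
  where
  m = mediant x y
  y≡x : Multiple (+ 3) 1ℤ x y
  y≡x = Multiple-cong 1ℤ k≡1 y≡kx

-- Descent to cross-determinant 1

Unimodular : ℚ → ℚ → Set
Unimodular u v = crossDet u v ≡ + 1

EventuallyUnimodular : ℚ → ℚ → Set
EventuallyUnimodular x y = ∃[ L ] (∀ i → L ℕ.≤ i → Linked Unimodular (row x y i))

quotient-nonneg : ∀ i g {D} → 0 ℕ.< g → i ℤ.* + g ≡ + D → ∃[ E ] i ≡ + E × D ≡ E ℕ.* g
quotient-nonneg (+ E)    g       _ eq = E , refl , ℤ.+-injective (trans (sym eq) (sym (ℤ.pos-* E g)))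
quotient-nonneg -[1+ _ ] (suc _) _ ()

module _ {x y : ℚ} where

  private
    m = mediant x y

  mediant-crossDets : ∀ {D} → crossDet x y ≡ + D → ∃[ E ] D ≡ E ℕ.* scale x y ×
    crossDet x m ≡ + E × crossDet m y ≡ + E
  mediant-crossDets D≡ =
    let E , xm≡E , D≡Eg = quotient-nonneg (crossDet x m) g (scale>0 x y) (trans (crossDet-lower x y) D≡)
        F , my≡F , D≡Fg = quotient-nonneg (crossDet m y) g (scale>0 x y) (trans (crossDet-upper x y) D≡)
        F≡E = ℕ.*-cancelʳ-≡ F E g {{ℕ.>-nonZero (scale>0 x y)}} (trans (sym D≡Fg) D≡Eg)
    in E , D≡Eg , xm≡E , trans my≡F (cong +_ F≡E)
    where
    g = scale x y

  Unimodular-mediant : Unimodular x y → Unimodular x m × Unimodular m y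
  Unimodular-mediant D≡1 =
    let E , 1≡Eg , xm≡E , my≡E = mediant-crossDets D≡1
        E≡1 = cong +_ (ℕ.m*n≡1⇒m≡1 E (scale x y) (sym 1≡Eg))
    in trans xm≡E E≡1 , trans my≡E E≡1

  EventuallyUnimodular-join :
    EventuallyUnimodular x m → EventuallyUnimodular m y → EventuallyUnimodular x y
  -- The extra 1 accounts for the row that creates `m`.
  EventuallyUnimodular-join (K , lower) (L , upper) = suc (K ℕ.⊔ L) , λ where
    (suc i) (s≤s K⊔L≤i) → Join-Linked (row-Join x y i)
      (lower i (ℕ.m⊔n≤o⇒m≤o K L K⊔L≤i)) (upper i (ℕ.m⊔n≤o⇒n≤o K L K⊔L≤i))

insertMediants-Unimodular : ∀ {xs} → Linked Unimodular xs → Linked Unimodular (insertMediants xs)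
insertMediants-Unimodular []       = []
insertMediants-Unimodular [-]      = [-]
insertMediants-Unimodular {x ∷ y ∷ _} (D≡1 ∷ ls) =
  let xm≡1 , my≡1 = Unimodular-mediant {x} {y} D≡1
  in xm≡1 ∷ prepend my≡1 (insertMediants-Unimodular ls)
  where
  -- `insertMediants (y ∷ ys)` starts with `y` in either case, but shows it only after a split on
  -- `ys`.
  prepend : ∀ {m ys} → Unimodular m y → Linked Unimodular (insertMediants (y ∷ ys)) →
    Linked Unimodular (m ∷ insertMediants (y ∷ ys))
  prepend {ys = []}    u ls = u ∷ ls
  prepend {ys = _ ∷ _} u ls = u ∷ ls

Unimodular⇒EventuallyUnimodular : ∀ {x y} → Unimodular x y → EventuallyUnimodular x y
Unimodular⇒EventuallyUnimodular {x} {y} D≡1 = 0 , λ i _ → linked i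
  where
  linked : ∀ i → Linked Unimodular (row x y i)
  linked zero    = D≡1 ∷ [-]
  linked (suc i) = insertMediants-Unimodular (linked i)

-- Descent through the divisors of 2^m 3^n

∣prime*⇒ : ∀ {p d} n → Prime p → d ℕ.∣ p ℕ.* n → p ℕ.∣ d ⊎ d ℕ.∣ n
∣prime*⇒ {p} {d} n pp (ℕ.divides q pn≡qd)
  with euclidsLemma q d pp (ℕ.divides n (trans (sym pn≡qd) (ℕ.*-comm p n)))
... | inj₂ p∣d = inj₁ p∣d
-- Here q = r p, and cancelling `p` from p n = r p d leaves n = r d.
... | inj₁ (ℕ.divides r refl) = inj₂ (ℕ.divides r
  (ℕ.*-cancelˡ-≡ n (r ℕ.* d) p {{prime⇒nonZero pp}}
    (trans pn≡qd (trans (cong (ℕ._* d) (ℕ.*-comm r p)) (ℕ.*-assoc p r d)))))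

-- Prime factors are removed one at a time: one that does not divide `d` leaves `d` a divisor of the
-- remaining product.
∣2^m*3^n⇒ : ∀ m n {d} → d ℕ.∣ 2 ^ m ℕ.* 3 ^ n → d ≡ 1 ⊎ 2 ℕ.∣ d ⊎ 3 ℕ.∣ d
∣2^m*3^n⇒ zero zero d∣1 = inj₁ (ℕ.∣1⇒≡1 d∣1)
∣2^m*3^n⇒ zero (suc n) {d} d∣N
  with ∣prime*⇒ (3 ^ n) (from-yes (prime? 3)) (subst (d ℕ.∣_) (ℕ.+-identityʳ (3 ^ suc n)) d∣N)
... | inj₁ 3∣d = inj₂ (inj₂ 3∣d)
... | inj₂ d∣N′ = ∣2^m*3^n⇒ zero n (subst (d ℕ.∣_) (sym (ℕ.+-identityʳ (3 ^ n))) d∣N′)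
∣2^m*3^n⇒ (suc m) n {d} d∣N
  with ∣prime*⇒ (2 ^ m ℕ.* 3 ^ n) prime[2] (subst (d ℕ.∣_) (ℕ.*-assoc 2 (2 ^ m) (3 ^ n)) d∣N)
... | inj₁ 2∣d  = inj₂ (inj₁ 2∣d)
... | inj₂ d∣N′ = ∣2^m*3^n⇒ m n d∣N′

∣crossDet : ∀ d {D x y} → crossDet x y ≡ + D → d ℕ.∣ D → + d ℤ∣.∣ crossDet x y
∣crossDet d D≡ d∣D = subst (+ d ℤ∣.∣_) (sym D≡) (∣ᵤ⇒∣ d∣D)

module _ (m n : ℕ) where

  private
    N = 2 ^ m ℕ.* 3 ^ n

    instance
      N≢0 : ℕ.NonZero N
      N≢0 = ℕ.m*n≢0 (2 ^ m) (3 ^ n) {{ℕ.m^n≢0 2 m}} {{ℕ.m^n≢0 3 n}}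

  -- The invariant `D ∣ N` passes to every quotient of `D`, so no exponents of 2 and 3 have to be
  -- tracked.
  eventuallyUnimodular : ∀ {D} → Acc ℕ._<_ D → D ℕ.∣ N →
    ∀ x y → crossDet x y ≡ + D → EventuallyUnimodular x y
  eventuallyUnimodular {D} (acc rec) D∣N x y D≡ with ∣2^m*3^n⇒ m n D∣N
  ... | inj₁ refl    = Unimodular⇒EventuallyUnimodular {x} {y} D≡
  ... | inj₂ 2∣D⊎3∣D = descend 2∣D⊎3∣D
    where
    w = mediant x y

    instance
      D≢0 : ℕ.NonZero D
      D≢0 = ℕ.≢-nonZero λ { refl → ℕ.≢-nonZero⁻¹ N (ℕ.0∣⇒≡0 D∣N) }

    -- Stated for every pair with cross-determinant `D`, since it also serves for the two halves of
    -- `(x , y)` when g = 1.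
    split : ∀ u v → crossDet u v ≡ + D → 1 ℕ.< scale u v → EventuallyUnimodular u v
    split u v D≡ 1<g =
      let E , D≡Eg , uw≡E , wv≡E = mediant-crossDets {u} {v} D≡
          E∣N = ℕ.∣-trans (ℕ.divides (scale u v) (trans D≡Eg (ℕ.*-comm E _))) D∣N
          E≢0 = λ E≡0 → ℕ.≢-nonZero⁻¹ D (trans D≡Eg (cong (ℕ._* scale u v) E≡0))
          E<D = subst (E ℕ.<_) (sym D≡Eg) (ℕ.m<m*n E (scale u v) {{ℕ.≢-nonZero E≢0}} 1<g)
      in EventuallyUnimodular-join {u} {v}
        (eventuallyUnimodular (rec E<D) E∣N u (mediant u v) uw≡E)
        (eventuallyUnimodular (rec E<D) E∣N (mediant u v) v wv≡E)

    ∣scale⇒1<scale : ∀ {d} u v → 1 ℕ.< d → d ℕ.∣ scale u v → 1 ℕ.< scale u v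
    ∣scale⇒1<scale u v 1<d d∣g = ℕ.<-≤-trans 1<d (ℕ.∣⇒≤ {{ℕ.>-nonZero (scale>0 u v)}} d∣g)

    descend₃ : 1 ℕ.< scale x y ⊎ 1 ≡ scale x y →
      3 ℕ.∣ scale x y ⊎ (scale x y ≡ 1 → 3 ℕ.∣ scale x w × 3 ℕ.∣ scale w y) →
      EventuallyUnimodular x y
    descend₃ (inj₁ 1<g) _          = split x y D≡ 1<g
    descend₃ (inj₂ _)   (inj₁ 3∣g) = split x y D≡ (∣scale⇒1<scale x y ℕ.sz<ss 3∣g)
    -- Nothing cancels in this row, so both halves keep cross-determinant `D`; the drop comes with
    -- their own mediants.
    descend₃ (inj₂ 1≡g) (inj₂ next) =
      let 3∣lower , 3∣upper = next (sym 1≡g)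
          E , D≡Eg , xw≡E , wy≡E = mediant-crossDets {x} {y} D≡
          E≡D = cong +_ (sym (trans D≡Eg (trans (cong (E ℕ.*_) (sym 1≡g)) (ℕ.*-identityʳ E))))
      in EventuallyUnimodular-join {x} {y}
        (split x w (trans xw≡E E≡D) (∣scale⇒1<scale x w ℕ.sz<ss 3∣lower))
        (split w y (trans wy≡E E≡D) (∣scale⇒1<scale w y ℕ.sz<ss 3∣upper))

    descend : 2 ℕ.∣ D ⊎ 3 ℕ.∣ D → EventuallyUnimodular x y
    descend (inj₁ 2∣D) = split x y D≡ (∣scale⇒1<scale x y ℕ.sz<ss
      (2∣crossDet⇒2∣scale x y (∣crossDet 2 {x = x} {y} D≡ 2∣D)))
    descend (inj₂ 3∣D) = descend₃ (ℕ.m≤n⇒m<n∨m≡n (scale>0 x y))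
      (3∣crossDet⇒3∣scale x y (∣crossDet 3 {x = x} {y} D≡ 3∣D))

theorem3p3 : (x y : ℚ) → 0ℚ ≤ x → x < y →
    (m n : ℕ) → crossDet x y ≡ + (2 ^ m ℕ.* 3 ^ n) →
    (∀ (q : ℚ) → x ≤ q → q ≤ y → ∃[ i ] q ∈ row x y i)
    × (∃[ L ] (∀ (i : ℕ) → L ℕ.≤ i → Linked (λ u v → crossDet u v ≡ + 1) (row x y i)))
theorem3p3 x y _ _ m n D≡ =
  (λ _ → appears-closed) ,
  eventuallyUnimodular m n (<-wellFounded _) ℕ.∣-refl x y D≡
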